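{- Let $x_1,x_2,x_3,x_4$ be prime numbers and let $a,b$ be positive integers such that (i) $x_1+x_2+x_3+x_4=a^2$; (ii) $\sum_{i=1}^{4}\mathrm{dgs}(x_i)=b^2$; (iii) $\mathrm{dgs}(a^2)+\mathrm{dgs}(b^2)=\mathrm{dgs}(a^2+b^2)$; (iv) $a^2+b^2$ is a prime of the form $4s+1$ for some positive integer $s$. Then $b>3$.
   Context: For a positive integer $n$, $\mathrm{dgs}(n)$ denotes the sum of all digits of $n$ in its decimal representation. The primes $x_1,\dots,x_4$ need not be distinct. -}

module Defs where

open import Data.Digit using (toDigits)
open import Data.Fin.Base using (toℕ)
open import Data.List.Base using (map)
open import Data.Nat.Base using (ℕ)
open import Data.Nat.ListAction using (sum)
open import Data.Product.Base using (proj₁)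

-- The sum of the decimal digits; dgs 0 = 0.
dgs : ℕ → ℕ
dgs n = sum (map toℕ (proj₁ (toDigits 10 n)))

{-# OPTIONS --safe #-}
-- A prime is neither 1 nor divisible by 10, so its digit sum is at least 2.
-- Hence b² ≥ 8, which excludes b ≤ 2.  For b = 3, casting out nines in (i) and
-- (ii) gives a² ≡ b² ≡ 0 (mod 9), so 3 divides the prime a² + 9, which is absurd.
module Submission where

open import Defs
open import Data.Digit using (Expansion; fromDigits; toDigits)
open import Data.Fin.Base using (zero; suc; toℕ)
open import Data.List.Base using ([]; _∷_; map)
open import Data.Nat.Base
  using (ℕ; zero; suc; _+_; _*_; _^_; _≤_; _<_; _>_; z≤n; s≤s)
open import Data.Nat.Divisibility using (_∣_; n∣m*n)
open import Data.Nat.ListAction using (sum)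
open import Data.Nat.Primality
  using (Prime; prime?; prime⇒irreducible; ¬prime[0]; ¬prime[1])
open import Data.Nat.Properties using (_≤?_; +-mono-≤)
open import Data.Nat.Tactic.RingSolver using (solve-∀)
open import Data.Product.Base using (_×_; _,_; proj₁; proj₂; ∃-syntax)
open import Data.Sum.Base using (inj₁; inj₂)
open import Relation.Binary.PropositionalEquality
  using (_≡_; refl; sym; trans; cong; cong₂; subst; module ≡-Reasoning)
open import Relation.Nullary.Decidable using (from-no)
open import Relation.Nullary.Negation using (¬_; contradiction)

digitSum : ∀ {base} → Expansion base → ℕ
digitSum ds = sum (map toℕ ds)

-- An `Expansion` may carry high-order zeros, so a vanishing digit sum does not force `ds` to be
-- empty. This identifies `1` followed only by such zeros with the number 1.
digitSum≡0⇒fromDigits≡0 : ∀ {base} (ds : Expansion base) →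
  digitSum ds ≡ 0 → fromDigits ds ≡ 0
digitSum≡0⇒fromDigits≡0        []          _  = refl
digitSum≡0⇒fromDigits≡0 {base} (zero ∷ ds) eq =
  cong (_* base) (digitSum≡0⇒fromDigits≡0 ds eq)

-- Casting out nines, by induction along Horner's scheme, since 10 = 1 + 9. The explicit `k`
-- replaces a congruence.
fromDigits≡digitSum+9k : (ds : Expansion 10) →
  ∃[ k ] fromDigits ds ≡ digitSum ds + k * 9
fromDigits≡digitSum+9k []       = 0 , refl
fromDigits≡digitSum+9k (d ∷ ds) with fromDigits≡digitSum+9k ds
-- With s the digit sum of `ds`, the surplus comes from s * 10 = s + s * 9 and k * 9 * 10 = (k * 10)
-- * 9.
... | k , eq = digitSum ds + k * 10 , (begin
  toℕ d + fromDigits ds * 10             ≡⟨ cong (λ n → toℕ d + n * 10) eq ⟩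
  toℕ d + (digitSum ds + k * 9) * 10     ≡⟨ regroup (toℕ d) (digitSum ds) k ⟩
  toℕ d + digitSum ds + (digitSum ds + k * 10) * 9 ∎)
  where
  open ≡-Reasoning
  regroup : ∀ d s k → d + (s + k * 9) * 10 ≡ d + s + (s + k * 10) * 9
  regroup = solve-∀

prime⇒10∤ : ∀ {p} → Prime p → ¬ 10 ∣ p
prime⇒10∤ pp 10∣p with prime⇒irreducible pp 10∣p
-- The alternative 10 ≡ 1 is absurd by constructors; what remains is that the prime is 10 itself,
-- refuted by computation.
... | inj₂ refl = contradiction pp (from-no (prime? 10))

-- The head of the list is the units digit. If it is 0, the value is a multiple of 10; if it is 1,
-- the other digits cannot all vanish, or the value would be 1; from 2 on it suffices alone.
prime⇒2≤digitSum : (ds : Expansion 10) → Prime (fromDigits ds) → 2 ≤ digitSum ds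
prime⇒2≤digitSum []                 pp = contradiction pp ¬prime[0]
prime⇒2≤digitSum (zero ∷ ds)        pp =
  contradiction (n∣m*n (fromDigits ds)) (prime⇒10∤ pp)
prime⇒2≤digitSum (suc zero ∷ ds)    pp with digitSum ds in eq
... | suc _ = s≤s (s≤s z≤n)
... | zero  = contradiction
  (subst (λ n → Prime (1 + n * 10)) (digitSum≡0⇒fromDigits≡0 ds eq) pp) ¬prime[1]
prime⇒2≤digitSum (suc (suc _) ∷ ds) pp = s≤s (s≤s z≤n)

prime⇒2≤dgs : ∀ {p} → Prime p → 2 ≤ dgs p
prime⇒2≤dgs {p} pp with ds , eq ← toDigits 10 p =
  prime⇒2≤digitSum ds (subst Prime (sym eq) pp)

n≡dgs[n]+9k : ∀ n → ∃[ k ] n ≡ dgs n + k * 9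
n≡dgs[n]+9k n with ds , eq ← toDigits 10 n with k , eq′ ← fromDigits≡digitSum+9k ds =
  k , trans (sym eq) eq′

sum₄≡dgs+9k : ∀ w x y z →
  ∃[ k ] w + x + y + z ≡ dgs w + dgs x + dgs y + dgs z + k * 9
sum₄≡dgs+9k w x y z
  with j , w≡ ← n≡dgs[n]+9k w | k , x≡ ← n≡dgs[n]+9k x
     | l , y≡ ← n≡dgs[n]+9k y | m , z≡ ← n≡dgs[n]+9k z =
  j + k + l + m ,
  trans (cong₂ _+_ (cong₂ _+_ (cong₂ _+_ w≡ x≡) y≡) z≡)
        (regroup (dgs w) (dgs x) (dgs y) (dgs z) j k l m)
  where
  regroup : ∀ a b c d j k l m →
    (a + j * 9) + (b + k * 9) + (c + l * 9) + (d + m * 9)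
      ≡ a + b + c + d + (j + k + l + m) * 9
  regroup = solve-∀

-- The cofactor `3 + n` exposes enough successors for both 3 ≡ 1 and 3 ≡ (3 + n) * 3 to be refuted
-- by constructors.
¬prime[[3+n]*3] : ∀ {n} → ¬ Prime ((3 + n) * 3)
¬prime[[3+n]*3] {n} pp with prime⇒irreducible pp (n∣m*n (3 + n) {3})
... | inj₁ ()
... | inj₂ ()

¬prime[9+9k+9] : ∀ k → ¬ Prime (9 + k * 9 + 9)
¬prime[9+9k+9] k pp = ¬prime[[3+n]*3] {3 + k * 3} (subst Prime (regroup k) pp)
  where
  regroup : ∀ k → 9 + k * 9 + 9 ≡ (3 + (3 + k * 3)) * 3
  regroup = solve-∀

8≤b²⇒b≢3⇒b>3 : ∀ b → 8 ≤ b ^ 2 → ¬ b ≡ 3 → b > 3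
8≤b²⇒b≢3⇒b>3 0 8≤0 _   = contradiction 8≤0 (from-no (8 ≤? 0))
8≤b²⇒b≢3⇒b>3 1 8≤1 _   = contradiction 8≤1 (from-no (8 ≤? 1))
8≤b²⇒b≢3⇒b>3 2 8≤4 _   = contradiction 8≤4 (from-no (8 ≤? 4))
8≤b²⇒b≢3⇒b>3 3 _   3≢3 = contradiction refl 3≢3
8≤b²⇒b≢3⇒b>3 (suc (suc (suc (suc _)))) _ _ = s≤s (s≤s (s≤s (s≤s z≤n)))

proposition4p1 : ∀ (x₁ x₂ x₃ x₄ a b : ℕ) →
    Prime x₁ → Prime x₂ → Prime x₃ → Prime x₄ →
    0 < a → 0 < b →
    x₁ + x₂ + x₃ + x₄ ≡ a ^ 2 →
    dgs x₁ + dgs x₂ + dgs x₃ + dgs x₄ ≡ b ^ 2 →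
    dgs (a ^ 2) + dgs (b ^ 2) ≡ dgs (a ^ 2 + b ^ 2) →
    Prime (a ^ 2 + b ^ 2) × (∃[ s ] (0 < s × a ^ 2 + b ^ 2 ≡ 4 * s + 1)) →
    b > 3
proposition4p1 x₁ x₂ x₃ x₄ a b p₁ p₂ p₃ p₄ _ _ Σx≡a² Σdgs≡b² _ (a²+b²-prime , _) =
  8≤b²⇒b≢3⇒b>3 b 8≤b² b≢3
  where
  8≤b² : 8 ≤ b ^ 2
  8≤b² = subst (8 ≤_) Σdgs≡b²
    (+-mono-≤ (+-mono-≤ (+-mono-≤ (prime⇒2≤dgs p₁) (prime⇒2≤dgs p₂))
                        (prime⇒2≤dgs p₃))
              (prime⇒2≤dgs p₄))

  k : ℕ
  k = proj₁ (sum₄≡dgs+9k x₁ x₂ x₃ x₄)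

  a²≡b²+9k : a ^ 2 ≡ b ^ 2 + k * 9
  a²≡b²+9k = begin
    a ^ 2                 ≡⟨ Σx≡a² ⟨
    x₁ + x₂ + x₃ + x₄     ≡⟨ proj₂ (sum₄≡dgs+9k x₁ x₂ x₃ x₄) ⟩
    dgs x₁ + dgs x₂ + dgs x₃ + dgs x₄ + k * 9
                          ≡⟨ cong (_+ k * 9) Σdgs≡b² ⟩
    b ^ 2 + k * 9         ∎
    where open ≡-Reasoning

  b≢3 : ¬ b ≡ 3
  -- Replacing `a ^ 2` first leaves `b` as the only unknown besides `k`; at `b` = 3 both squares
  -- compute to 9.
  b≢3 b≡3 = ¬prime[9+9k+9] k
    (subst (λ c → Prime (c ^ 2 + k * 9 + c ^ 2)) b≡3
      (subst (λ n → Prime (n + b ^ 2)) a²≡b²+9k a²+b²-prime))
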